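{- There exists a constant $c \ge 25$ such that for every integer $k$ with $8 \le k \le c$ and $k \ne 9$, and all integers $p \ge k+2$ and $q \ge k+1$, $$r_k(p,q) \ge (p-1)\cdot\bigl(r_k(p-1,q)-1\bigr)+1.$$
   Context: For integers $k,p,q$, the Ramsey number $r_k(p,q)$ is the smallest integer $N$ such that for every coloring of all $k$-element subsets of $\{1,\dots,N\}$ with the colors red and blue, there exist either $p$ elements of $\{1,\dots,N\}$ all of whose $k$-element subsets are red, or $q$ elements of $\{1,\dots,N\}$ all of whose $k$-element subsets are blue. -}

module Defs where

open import Data.Fin.Subset using (Subset; _⊆_; ∣_∣)
open import Data.Nat using (ℕ; _≤_)
open import Data.Product using (Σ; _×_; proj₁; ∃-syntax)
open import Data.Sum using (_⊎_)
open import Relation.Binary.PropositionalEquality using (_≡_)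

data Colour : Set where
  red blue : Colour

-- The ground set {1, …, N} is represented by Fin N.
SubsetOfSize : ℕ → ℕ → Set
SubsetOfSize k N = Σ (Subset N) λ s → ∣ s ∣ ≡ k

Colouring : ℕ → ℕ → Set
Colouring k N = SubsetOfSize k N → Colour

Monochromatic : ∀ {k N} → Colouring k N → Colour → Subset N → Set
Monochromatic {k} {N} χ c s = (e : SubsetOfSize k N) → proj₁ e ⊆ s → χ e ≡ c

HasMonochromatic : ∀ {k N} → Colouring k N → Colour → ℕ → Set
HasMonochromatic {N = N} χ c m = ∃[ s ] ∣ s ∣ ≡ m × Monochromatic χ c s

RamseyProperty : (k p q N : ℕ) → Set
RamseyProperty k p q N =
  (χ : Colouring k N) → HasMonochromatic χ red p ⊎ HasMonochromatic χ blue q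

-- N is the Ramsey number r_k(p,q).  It is given as a relation, functional in N
-- by minimality, so that naming r_k(p,q) does not presuppose a proof of
-- Ramsey's theorem.
record IsRamseyNumber (k p q N : ℕ) : Set where
  field
    ramsey  : RamseyProperty k p q N
    minimal : ∀ M → RamseyProperty k p q M → N ≤ M

{-# OPTIONS --safe #-}
module Submission where

-- Write p = m + 1.  The theorem is the contrapositive of a recursion: if every
-- colouring on m * N points has a red p-set or a blue q-set, then every
-- colouring on N points has a red m-set or a blue q-set (`recursion`).  With
-- N = r_k(m,q) - 1 the conclusion is false, so r_k(p,q) > m * N.
--
-- For the recursion, a colouring χ on N points is blown up to m disjoint blocks
-- of N points (`product`).  A k-set inside one block keeps its colour under χ;
-- a k-set meeting several blocks is coloured by a function κ of the list of its
-- intersection sizes with the blocks, and κ ignores the order of that list.  If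
-- a monochromatic p-set or q-set has a large intersection with a block, then χ
-- has the monochromatic set wanted (`large-block`).  It remains to choose κ so
-- that a set with small intersections is never monochromatic.
--
-- A blue q-set with small intersections meets two blocks and has at least k + 1
-- points; a red p-set with small intersections has at least two points outside
-- each block, at least k + 2 points in all, and, by the pigeonhole principle,
-- two points in a common block.  Discarding points (`partition-below`) reduces
-- the requirement on κ to two statements about partitions, the record `Good`:
--
--   * every partition of k + 1 into parts at most k can be lowered by 1 to a
--     partition of k that has no part k and is red;
--   * every partition of k + 2 into parts at most k, not all equal to 1, can be
--     lowered by 2 to a partition of k that has no part k and is blue.
--
-- A colouring with these properties is close to the following one.  Let e be the
-- number of even parts.  Lowering an even part lowers e, lowering an odd part
-- other than 1 raises e, and removing a part 1 keeps e.  So if blue means that 3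
-- divides e, then from most partitions both colours can be reached.  The
-- partitions that this leaves out are served by a modified colour for the
-- partitions with exactly one odd part and by a short list of exceptions; the
-- two statements are then verified, for each k in question, by evaluating a
-- decision procedure on all partitions of k + 1 and k + 2 (`good`).

open import Data.Bool using (Bool; true; false; not; _∧_; _xor_; if_then_else_)
open import Data.Fin using (Fin; zero; suc)
open import Data.Fin.Subset using (Subset; _⊆_; ∣_∣; ⊥; inside; outside)
open import Data.Fin.Subset.Properties
  using (⊆-trans; ⊆-min; out⊆; s⊆s; drop-∷-⊆; ∣⊥∣≡0; ∣p∣≤n)
open import Data.List
  using (List; []; _∷_; _++_; length; map; filter; foldr; replicate; applyUpTo; concatMap)
open import Data.List.Membership.Propositional using (_∈_)
open import Data.List.Membership.Propositional.Properties
  using (∈-++⁺ˡ; ∈-++⁺ʳ; ∈-map⁺; ∈-applyUpTo⁺)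
open import Data.List.Properties using (filter-accept; ≡-dec)
open import Data.List.Relation.Binary.Permutation.Propositional as ↭
  using (_↭_; prep; swap; ↭-sym; ↭⇒↭ₛ)
open import Data.List.Relation.Binary.Permutation.Propositional.Properties
  using (All-resp-↭; Any-resp-↭; filter-↭)
open import Data.List.Relation.Binary.Pointwise as Pointwise using (Pointwise; []; _∷_)
open import Data.List.Relation.Unary.All as All using (All; []; _∷_; all?)
open import Data.List.Relation.Unary.All.Properties
  using (¬Any⇒All¬; all-filter; filter⁺; map⁺)
open import Data.List.Relation.Unary.AllPairs using (AllPairs; []; _∷_)
open import Data.List.Relation.Unary.Any as Any using (Any; here; there; any?)
open import Data.List.Relation.Unary.Sorted.TotalOrder.Properties
  using (Sorted⇒AllPairs; ↗↭↗⇒≋)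
open import Data.Nat
open import Data.Nat.ListAction using (sum)
open import Data.Nat.ListAction.Properties using (sum-↭)
open import Data.Nat.Properties
open import Data.Product using (_×_; _,_; Σ-syntax; ∃-syntax; proj₁; proj₂)
open import Data.Sum as Sum using (inj₁; inj₂)
open import Data.Vec as Vec using (Vec; []; _∷_; concat; group; lookup; here)
open import Data.Vec.Properties using (++-injective)
open import Data.Vec.Relation.Binary.Pointwise.Inductive as Blockwise using ([]; _∷_)
open import Function using (_∘_; _$_)
open import Relation.Binary using (DecTotalOrder)
import Relation.Binary.Construct.Flip.EqAndOrd as Flip
open import Relation.Binary.PropositionalEquality
open import Relation.Nullary using (Dec; yes; no; does; contradiction)
open import Relation.Nullary.Decidable using (from-yes; map′; ¬?; _×-dec_; _→-dec_)
open import Defs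

-- Lists of sizes are sorted in descending order, like partitions.
≥-decTotalOrder : DecTotalOrder _ _ _
≥-decTotalOrder = Flip.decTotalOrder ≤-decTotalOrder

open DecTotalOrder ≥-decTotalOrder using () renaming (totalOrder to ≥-totalOrder)
open import Data.List.Relation.Unary.Sorted.TotalOrder ≥-totalOrder using (Sorted)
open import Data.List.Sort.InsertionSort.Base ≥-decTotalOrder using (sort)
open import Data.List.Sort.InsertionSort.Properties ≥-decTotalOrder using (sort-↭; sort-↗)
open import Data.List.Membership.DecPropositional (≡-dec _≟_) using (_∈?_)

private variable
  j k m n N : ℕ
  a b b′ : List ℕ
  c : Colour

-- Subsets of m blocks of N points

red≢blue : red ≢ blue
red≢blue ()

-- A subset of m * N points is handled as a vector of m subsets of N points, its
-- blocks; the sizes of the blocks form a list, possibly with zeros.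
sizes : Vec (Subset N) m → List ℕ
sizes []       = []
sizes (s ∷ ss) = ∣ s ∣ ∷ sizes ss

length-sizes : (ss : Vec (Subset N) m) → length (sizes ss) ≡ m
length-sizes []       = refl
length-sizes (s ∷ ss) = cong suc (length-sizes ss)

∣++∣ : (s : Subset m) (t : Subset n) → ∣ s Vec.++ t ∣ ≡ ∣ s ∣ + ∣ t ∣
∣++∣ []          t = refl
∣++∣ (true ∷ s)  t = cong suc (∣++∣ s t)
∣++∣ (false ∷ s) t = ∣++∣ s t

∣concat∣ : (ss : Vec (Subset N) m) → ∣ concat ss ∣ ≡ sum (sizes ss)
∣concat∣ []       = refl
∣concat∣ (s ∷ ss) = trans (∣++∣ s (concat ss)) (cong (∣ s ∣ +_) (∣concat∣ ss))

++-⊆ : {s s′ : Subset m} {t t′ : Subset n} → s ⊆ s′ → t ⊆ t′ →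
  s Vec.++ t ⊆ s′ Vec.++ t′
++-⊆ {s = []}        {[]}     _    t⊆t′ = t⊆t′
++-⊆ {s = false ∷ s} {_ ∷ s′} s⊆s′ t⊆t′ =
  out⊆ (++-⊆ {s = s} {s′} (drop-∷-⊆ s⊆s′) t⊆t′)
++-⊆ {s = true ∷ s}  {_ ∷ s′} s⊆s′ t⊆t′ with here ← s⊆s′ here =
  s⊆s (++-⊆ {s = s} {s′} (drop-∷-⊆ s⊆s′) t⊆t′)

concat-⊆ : {ss ts : Vec (Subset N) m} → Blockwise.Pointwise _⊆_ ss ts → concat ss ⊆ concat ts
concat-⊆ []          = λ ()
concat-⊆ {ss = s ∷ _} {t ∷ _} (p ∷ ps) = ++-⊆ {s = s} {t} p (concat-⊆ ps)

subset-of-size : (s : Subset n) → j ≤ ∣ s ∣ → ∃[ t ] t ⊆ s × ∣ t ∣ ≡ j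
subset-of-size []          z≤n  = [] , (λ ()) , refl
subset-of-size (false ∷ s) j≤s =
  let t , t⊆s , ∣t∣ = subset-of-size s j≤s in false ∷ t , s⊆s t⊆s , ∣t∣
subset-of-size {n = suc n} (true ∷ s) z≤n = ⊥ , ⊆-min (true ∷ s) , ∣⊥∣≡0 (suc n)
subset-of-size (true ∷ s) (s≤s j≤s) =
  let t , t⊆s , ∣t∣ = subset-of-size s j≤s in true ∷ t , s⊆s t⊆s , cong suc ∣t∣

subsets-of-sizes : (ss : Vec (Subset N) m) {a : List ℕ} → Pointwise _≤_ a (sizes ss) →
  Σ[ ts ∈ Vec (Subset N) m ] Blockwise.Pointwise _⊆_ ts ss × sizes ts ≡ a
subsets-of-sizes []       []       = [] , [] , refl
subsets-of-sizes (s ∷ ss) (p ∷ ps) =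
  let t  , t⊆s   , ∣t∣ = subset-of-size s p
      ts , ts⊆ss , ∣ts∣ = subsets-of-sizes ss ps
  in t ∷ ts , t⊆s ∷ ts⊆ss , cong₂ _∷_ ∣t∣ ∣ts∣

blocks : ∀ m → Subset (m * N) → Vec (Subset N) m
blocks {N} m s = proj₁ (group m N s)

concat-blocks : ∀ m (s : Subset (m * N)) → concat (blocks m s) ≡ s
concat-blocks {N} m s = sym (proj₂ (group m N s))

concat-injective : (ss ts : Vec (Subset N) m) → concat ss ≡ concat ts → ss ≡ ts
concat-injective []       []       _  = refl
concat-injective (s ∷ ss) (t ∷ ts) eq =
  let s≡t , eq′ = ++-injective s t eq in cong₂ _∷_ s≡t (concat-injective ss ts eq′)

blocks-concat : (ss : Vec (Subset N) m) → blocks m (concat ss) ≡ ss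
blocks-concat {m = m} ss = concat-injective _ ss (concat-blocks m (concat ss))

-- The blocks of a set that is contained in block i and equal to s there.
only : Fin m → Subset N → Vec (Subset N) m
only {suc m} zero    s = s ∷ Vec.replicate m ⊥
only         (suc i) s = ⊥ ∷ only i s

only-⊆ : (i : Fin m) {s : Subset N} (ss : Vec (Subset N) m) → s ⊆ lookup ss i →
  Blockwise.Pointwise _⊆_ (only i s) ss
only-⊆ (suc i) (t ∷ ss) s⊆ = ⊆-min t ∷ only-⊆ i ss s⊆
only-⊆ {N = N} zero (t ∷ ss) s⊆ = s⊆ ∷ empty ss
  where
  empty : (ss : Vec (Subset N) m) → Blockwise.Pointwise _⊆_ (Vec.replicate m ⊥) ss
  empty []       = []
  empty (t ∷ ss) = ⊆-min t ∷ empty ss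

sum-sizes-only : (i : Fin m) (s : Subset N) → sum (sizes (only i s)) ≡ ∣ s ∣
sum-sizes-only {N = N} (suc i) s = cong₂ _+_ (∣⊥∣≡0 N) (sum-sizes-only i s)
sum-sizes-only {m = suc m} {N} zero s = trans (cong (∣ s ∣ +_) (empty m)) (+-identityʳ ∣ s ∣)
  where
  empty : ∀ m → sum (sizes (Vec.replicate m (⊥ {N}))) ≡ 0
  empty zero    = refl
  empty (suc m) = cong₂ _+_ (∣⊥∣≡0 N) (empty m)

-- The blow-up of a colouring

-- The colour under χ of the first block of size k; the default d if there is
-- none.  The blocks of a k-set with k > 0 contain at most one of size k, so for
-- these the order of the blocks does not matter.
blockColour : Colouring k N → Colour → Vec (Subset N) m → Colour
blockColour χ d [] = d
blockColour {k} χ d (s ∷ ss) with ∣ s ∣ ≟ k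
... | yes ∣s∣≡k = χ (s , ∣s∣≡k)
... | no  _     = blockColour χ d ss

-- The blow-up of χ to m blocks.  The colour of a set that is contained in no
-- block is given by κ, applied to the sizes of its intersections with the blocks.
product : Colouring k N → (List ℕ → Colour) → Colouring k (m * N)
product {m = m} χ κ (e , _) = blockColour χ (κ (sizes (blocks m e))) (blocks m e)

blockColour-spread : (χ : Colouring k N) (d : Colour) (ss : Vec (Subset N) m) →
  All (_≢ k) (sizes ss) → blockColour χ d ss ≡ d
blockColour-spread χ d []       []       = refl
blockColour-spread {k} χ d (s ∷ ss) (p ∷ ps) with ∣ s ∣ ≟ k
... | yes ∣s∣≡k = contradiction ∣s∣≡k p
... | no  _     = blockColour-spread χ d ss ps

blockColour-only : 0 < k → (χ : Colouring k N) (d : Colour) (i : Fin m)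
  (s : Subset N) (∣s∣≡k : ∣ s ∣ ≡ k) →
  blockColour χ d (only i s) ≡ χ (s , ∣s∣≡k)
blockColour-only {k} 0<k χ d zero s eq with ∣ s ∣ ≟ k
... | yes eq′ = cong (λ e → χ (s , e)) (≡-irrelevant eq′ eq)
... | no  ≢k  = contradiction eq ≢k
blockColour-only {k} {N} 0<k χ d (suc i) s eq with ∣ ⊥ {N} ∣ ≟ k
... | yes 0≡k = contradiction (trans (sym (∣⊥∣≡0 N)) 0≡k) (<⇒≢ 0<k)
... | no  _   = blockColour-only 0<k χ d i s eq

module _ (χ : Colouring k N) (κ : List ℕ → Colour) {S : Subset (m * N)}
         (mono : Monochromatic (product {m = m} χ κ) c S) where

  colour-of-subblocks : (ts : Vec (Subset N) m) → Blockwise.Pointwise _⊆_ ts (blocks m S) →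
    sum (sizes ts) ≡ k → blockColour χ (κ (sizes ts)) ts ≡ c
  colour-of-subblocks ts ts⊆ eq =
    subst (λ us → blockColour χ (κ (sizes us)) us ≡ c) (blocks-concat ts)
      (mono (concat ts , trans (∣concat∣ ts) eq)
            (subst (concat ts ⊆_) (concat-blocks m S) (concat-⊆ ts⊆)))

  -- Every list of sizes below those of S is the list of sizes of a subset of S, so
  -- κ is constant on such lists as long as they are not concentrated in one block.
  spread-colour : Pointwise _≤_ a (sizes (blocks m S)) → sum a ≡ k → All (_≢ k) a →
    κ a ≡ c
  spread-colour {a} a≤ sum≡ spread =
    let ts , ts⊆ , ∣ts∣ = subsets-of-sizes (blocks m S) a≤
        spread′ = subst (All (_≢ k)) (sym ∣ts∣) spread
    in begin
    κ a                             ≡⟨ cong κ ∣ts∣ ⟨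
    κ (sizes ts)                    ≡⟨ blockColour-spread χ _ ts spread′ ⟨
    blockColour χ (κ (sizes ts)) ts ≡⟨ colour-of-subblocks ts ts⊆ (trans (cong sum ∣ts∣) sum≡) ⟩
    c                               ∎
    where open ≡-Reasoning

  block-monochromatic : 0 < k → (i : Fin m) → Monochromatic χ c (lookup (blocks m S) i)
  block-monochromatic 0<k i (s , ∣s∣≡k) s⊆ =
    trans (sym (blockColour-only 0<k χ _ i s ∣s∣≡k))
          (colour-of-subblocks (only i s) (only-⊆ i (blocks m S) s⊆)
                               (trans (sum-sizes-only i s) ∣s∣≡k))

  large-block : 0 < k → Any (j ≤_) (sizes (blocks m S)) → HasMonochromatic χ c j
  large-block 0<k big =
    let i , j≤ = block-index (blocks m S) big
        t , t⊆ , ∣t∣ = subset-of-size (lookup (blocks m S) i) j≤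
    in t , ∣t∣ , λ e e⊆t → block-monochromatic 0<k i e (⊆-trans e⊆t t⊆)
    where
    block-index : ∀ {n} (ss : Vec (Subset N) n) → Any (j ≤_) (sizes ss) →
      ∃[ i ] j ≤ ∣ lookup ss i ∣
    block-index (s ∷ ss) (here  p) = zero , p
    block-index (s ∷ ss) (there p) = let i , q = block-index ss p in suc i , q

-- A set whose intersections with the blocks have sizes b contains a k-set, not
-- inside one block, to which κ gives the colour c.
Contains : (List ℕ → Colour) → ℕ → Colour → List ℕ → Set
Contains κ k c b = ∃[ a ] Pointwise _≤_ a b × sum a ≡ k × All (_≢ k) a × κ a ≡ c

-- The recursion for Ramsey numbers, given a κ for which no set with small
-- intersections with the blocks is monochromatic.
product-bound : 0 < k → (κ : List ℕ → Colour) (m q : ℕ) →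
  (∀ b → length b ≡ m → sum b ≡ suc m → All (_< m) b → Contains κ k blue b) →
  (∀ b → sum b ≡ q → All (_< q) b → Contains κ k red b) →
  ∀ {N} → RamseyProperty k (suc m) q (m * N) → RamseyProperty k m q N
product-bound {k} 0<k κ m q hasBlue hasRed {N} ramsey χ with ramsey (product {m = m} χ κ)
... | inj₁ (S , ∣S∣ , mono) with any? (m ≤?_) (sizes (blocks m S))
...   | yes big  = inj₁ (large-block χ κ mono 0<k big)
...   | no small =
  let a , a≤ , sum≡ , spread , κa≡blue =
        hasBlue (sizes (blocks m S)) (length-sizes (blocks m S))
          (trans (sym (∣concat∣ (blocks m S))) (trans (cong ∣_∣ (concat-blocks m S)) ∣S∣))
          (All.map ≰⇒> (¬Any⇒All¬ _ small))
  in contradiction (trans (sym (spread-colour χ κ mono a≤ sum≡ spread)) κa≡blue) red≢blue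
product-bound {k} 0<k κ m q hasBlue hasRed {N} ramsey χ
    | inj₂ (S , ∣S∣ , mono) with any? (q ≤?_) (sizes (blocks m S))
...   | yes big  = inj₂ (large-block χ κ mono 0<k big)
...   | no small =
  let a , a≤ , sum≡ , spread , κa≡red =
        hasRed (sizes (blocks m S))
          (trans (sym (∣concat∣ (blocks m S))) (trans (cong ∣_∣ (concat-blocks m S)) ∣S∣))
          (All.map ≰⇒> (¬Any⇒All¬ _ small))
  in contradiction (trans (sym κa≡red) (spread-colour χ κ mono a≤ sum≡ spread)) red≢blue

-- Adding a point, which belongs to none of the sets involved, is the whole step
-- from N to N + 1.
ramsey-mono : ∀ {k p q M N} → M ≤ N → RamseyProperty k p q M → RamseyProperty k p q N
ramsey-mono = go ∘ ≤⇒≤′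
  where
  add-point : ∀ {c} (χ : Colouring k (suc N)) →
    HasMonochromatic {k} (λ (e , ∣e∣≡k) → χ (outside ∷ e , ∣e∣≡k)) c j → HasMonochromatic χ c j
  add-point χ (s , ∣s∣ , mono) = outside ∷ s , ∣s∣ , λ where
    (inside  ∷ e , _)     e⊆ → contradiction (e⊆ here) λ ()
    (outside ∷ e , ∣e∣≡k) e⊆ → mono (e , ∣e∣≡k) (drop-∷-⊆ e⊆)

  go : ∀ {k p q M N} → M ≤′ N → RamseyProperty k p q M → RamseyProperty k p q N
  go ≤′-refl         ramsey   = ramsey
  go (≤′-step M≤′N) ramsey χ = Sum.map (add-point χ) (add-point χ) (go M≤′N ramsey _)

-- Colouring lists of sizes up to order

-- The entries greater than 1, in descending order.  Given the sum of the list, the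
-- core determines it up to order and zeros.
core : List ℕ → List ℕ
core a = sort (filter (2 ≤?_) a)

sort-cong-↭ : a ↭ b → sort a ≡ sort b
sort-cong-↭ {a} {b} a↭b = Pointwise.Pointwise-≡⇒≡ $
  ↗↭↗⇒≋ ≥-totalOrder (sort-↗ a) (sort-↗ b)
    (↭⇒↭ₛ (↭.trans (sort-↭ a) (↭.trans a↭b (↭-sym (sort-↭ b)))))

core-cong-↭ : a ↭ b → core a ≡ core b
core-cong-↭ a↭b = sort-cong-↭ (filter-↭ (2 ≤?_) a↭b)

positives : List ℕ → List ℕ
positives = filter (1 ≤?_)

sum-positives : ∀ b → sum (positives b) ≡ sum b
sum-positives []          = refl
sum-positives (zero  ∷ b) = sum-positives b
sum-positives (suc x ∷ b) = cong (suc x +_) (sum-positives b)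

≤-across-↭ : b ↭ b′ → Pointwise _≤_ a b′ → ∃[ a′ ] a′ ↭ a × Pointwise _≤_ a′ b
≤-across-↭ ↭.refl a≤ = _ , ↭.refl , a≤
≤-across-↭ (prep x p) (h ∷ a≤) =
  let _ , q , a′≤ = ≤-across-↭ p a≤ in _ , prep _ q , h ∷ a′≤
≤-across-↭ (swap x y p) (h ∷ i ∷ a≤) =
  let _ , q , a′≤ = ≤-across-↭ p a≤ in _ , swap _ _ q , i ∷ h ∷ a′≤
≤-across-↭ (↭.trans p₁ p₂) a≤ =
  let _ , q₂ , a₂≤ = ≤-across-↭ p₂ a≤
      _ , q₁ , a₁≤ = ≤-across-↭ p₁ a₂≤
  in _ , ↭.trans q₁ q₂ , a₁≤

≤-of-positives : ∀ b → Pointwise _≤_ a (positives b) →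
  ∃[ a′ ] Pointwise _≤_ a′ b × positives a′ ≡ positives a
≤-of-positives [] [] = [] , [] , refl
≤-of-positives (zero ∷ b) a≤ =
  let a′ , a′≤ , eq = ≤-of-positives b a≤ in 0 ∷ a′ , z≤n ∷ a′≤ , eq
≤-of-positives (suc x ∷ b) (_∷_ {x = zero} h a≤) =
  let a′ , a′≤ , eq = ≤-of-positives b a≤ in 0 ∷ a′ , h ∷ a′≤ , eq
≤-of-positives (suc x ∷ b) (_∷_ {x = suc y} h a≤) =
  let a′ , a′≤ , eq = ≤-of-positives b a≤ in suc y ∷ a′ , h ∷ a′≤ , cong (suc y ∷_) eq

filter-positives : ∀ a → filter (2 ≤?_) (positives a) ≡ filter (2 ≤?_) a
filter-positives []                = refl
filter-positives (zero ∷ a)        = filter-positives a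
filter-positives (suc zero ∷ a)    = filter-positives a
filter-positives (suc (suc x) ∷ a) = cong (suc (suc x) ∷_) (filter-positives a)

All-positives⁻ : {P : ℕ → Set} → P 0 → ∀ a → All P (positives a) → All P a
All-positives⁻ p0 []          []       = []
All-positives⁻ p0 (zero ∷ a)  ps       = p0 ∷ All-positives⁻ p0 a ps
All-positives⁻ p0 (suc x ∷ a) (p ∷ ps) = p ∷ All-positives⁻ p0 a ps

Pointwise-≤-trans : Pointwise _≤_ a b → Pointwise _≤_ b b′ → Pointwise _≤_ a b′
Pointwise-≤-trans = Pointwise.transitive ≤-trans

-- Partitions

-- The partitions of n into parts at most m, as descending lists of positive
-- numbers.  The fuel f bounds the number of parts; f = n is always enough.
partitions : (f n m : ℕ) → List (List ℕ)
partitions f       zero    m       = [] ∷ []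
partitions zero    (suc n) m       = []
partitions (suc f) (suc n) zero    = []
partitions (suc f) (suc n) (suc m) =
  (if m ≤ᵇ n then map (suc m ∷_) (partitions f (n ∸ m) (suc m)) else [])
  ++ partitions (suc f) (suc n) m

∈-partitions : ∀ f {n} m {s} → AllPairs _≥_ s → All (1 ≤_) s → All (_≤ m) s →
  sum s ≡ n → n ≤ f → s ∈ partitions f n m
∈-partitions f m {[]} _ _ _ refl _ = here refl
∈-partitions (suc f) (suc m) {suc x ∷ s} (x≥s ∷ s↘) (_ ∷ s≥1) (s≤s x≤m ∷ s≤m) refl (s≤s n≤f)
  with x ≟ m
... | no x≢m = ∈-++⁺ʳ _ $ ∈-partitions (suc f) m (x≥s ∷ s↘) (s≤s z≤n ∷ s≥1)
        (x<m ∷ All.map (λ y≤x → ≤-trans y≤x x<m) x≥s) refl (s≤s n≤f)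
  where x<m = ≤∧≢⇒< x≤m x≢m
... | yes refl with x ≤ᵇ x + sum s | ≤⇒≤ᵇ (m≤m+n x (sum s))
...   | true | _ = ∈-++⁺ˡ $ ∈-map⁺ (suc x ∷_) $
        ∈-partitions f (suc x) s↘ s≥1 s≤m (sym (m+n∸m≡n x (sum s))) (≤-trans (m∸n≤m (x + sum s) x) n≤f)

-- The lists obtained by lowering one positive entry by 1.
removals : List ℕ → List (List ℕ)
removals []          = []
removals (zero  ∷ b) = map (0 ∷_) (removals b)
removals (suc x ∷ b) = (x ∷ b) ∷ map (suc x ∷_) (removals b)

removals-spec : ∀ b → All (λ a → Pointwise _≤_ a b × suc (sum a) ≡ sum b) (removals b)
removals-spec []          = []
removals-spec (zero ∷ b)  = map⁺ (All.map (λ (a≤b , eq) → z≤n ∷ a≤b , eq) (removals-spec b))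
removals-spec (suc x ∷ b) = (n≤1+n x ∷ Pointwise.refl ≤-refl , refl) ∷
  map⁺ (All.map (λ {a} (a≤b , eq) →
                   ≤-refl ∷ a≤b , cong suc (trans (sym (+-suc x (sum a))) (cong (x +_) eq)))
                (removals-spec b))

-- The partition underlying a list of sizes.
descending : List ℕ → List ℕ
descending b = sort (positives b)

descending-∈-partitions : ∀ b → sum b ≡ n → All (_≤ m) b → descending b ∈ partitions n n m
descending-∈-partitions {n} {m} b sum≡ b≤m = ∈-partitions n m
  (Sorted⇒AllPairs ≥-totalOrder (sort-↗ (positives b)))
  (sorted (all-filter (1 ≤?_) b))
  (sorted (filter⁺ (1 ≤?_) b≤m))
  (trans (sum-↭ (sort-↭ (positives b))) (trans (sum-positives b) sum≡))
  ≤-refl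
  where
  sorted : {P : ℕ → Set} → All P (positives b) → All P (descending b)
  sorted = All-resp-↭ (↭-sym (sort-↭ (positives b)))

-- Lowering a list of sizes to a prescribed sum

trim : ∀ t l → t ≤ sum l → ∃[ l′ ] Pointwise _≤_ l′ l × sum l′ ≡ t
trim .0 []     z≤n = [] , [] , refl
trim t (x ∷ l) t≤  =
  let l′ , l′≤l , eq = trim (t ∸ x) l (m≤n+o⇒m∸n≤o t x t≤)
  in x ⊓ t ∷ l′ , m⊓n≤m x t ∷ l′≤l , trans (cong (x ⊓ t +_) eq) (m⊓n+n∸m≡n x t)

summand≤sum : ∀ l → All (_≤ sum l) l
summand≤sum []      = []
summand≤sum (x ∷ l) = m≤m+n x (sum l) ∷
  All.map (λ y≤ → ≤-trans y≤ (m≤n+m (sum l) x)) (summand≤sum l)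

All-≤-down : Pointwise _≤_ a b → All (_≤ k) b → All (_≤ k) a
All-≤-down []       []       = []
All-≤-down (p ∷ ps) (q ∷ qs) = ≤-trans p q ∷ All-≤-down ps qs

pigeonhole : ∀ b → length b < sum b → Any (2 ≤_) b
pigeonhole (zero ∷ b)        len< = there (pigeonhole b (<-trans (n<1+n _) len<))
pigeonhole (suc zero ∷ b)    len< = there (pigeonhole b (s<s⁻¹ len<))
pigeonhole (suc (suc x) ∷ b) _    = here (s≤s (s≤s z≤n))

-- A list with maximum x and sum at least k + j, of which at least j lies outside
-- the maximum, can be lowered to sum k + j and entries at most k in such a way
-- that the maximum is lowered to x ⊓ k.
truncate : ∀ {j x l} → j ≤ k → All (_≤ x) l → k + j ≤ x + sum l → j ≤ sum l →
  ∃[ l′ ] Pointwise _≤_ l′ l × x ⊓ k + sum l′ ≡ k + j × All (_≤ k) l′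
truncate {k} {j} {x} {l} j≤k l≤x k+j≤ j≤ with ≤-total x k
... | inj₁ x≤k rewrite m≤n⇒m⊓n≡m x≤k =
  let l′ , l′≤l , eq = trim (k + j ∸ x) l (m≤n+o⇒m∸n≤o (k + j) x k+j≤)
  in l′ , l′≤l
   , trans (cong (x +_) eq) (m+[n∸m]≡n (≤-trans x≤k (m≤m+n k j)))
   , All-≤-down l′≤l (All.map (λ y≤x → ≤-trans y≤x x≤k) l≤x)
... | inj₂ k≤x rewrite m≥n⇒m⊓n≡n k≤x =
  let l′ , l′≤l , eq = trim j l j≤
  in l′ , l′≤l , cong (k +_) eq
   , All.map (λ y≤ → ≤-trans y≤ (≤-trans (≤-reflexive eq) j≤k)) (summand≤sum l′)

-- The conditions on a colouring of partitions

-- A rule assigning colours to cores gives a colouring κ of lists of sizes that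
-- depends neither on their order nor on zeros.
module BlockRule (k : ℕ) (rule : List ℕ → Colour) where
  κ : List ℕ → Colour
  κ = rule ∘ core

  -- The k-sets with sizes a are not inside one block and have the colour c.
  Spread : Colour → List ℕ → Set
  Spread c a = All (_≢ k) a × κ a ≡ c

  -- Removing one point can leave a red k-set, and removing two points a blue one.
  RedBelow BlueBelow : List ℕ → Set
  RedBelow μ  = Any (Spread red) (removals μ)
  BlueBelow μ = Any (Any (Spread blue) ∘ removals) (removals μ)

  -- The finite condition under which the blow-up proves the recursion.
  record Good : Set where
    field
      red-below  : All RedBelow (partitions (k + 1) (k + 1) k)
      blue-below : All (λ μ → Any (2 ≤_) μ → BlueBelow μ) (partitions (k + 2) (k + 2) k)

  Contains-mono : Pointwise _≤_ b b′ → Contains κ k c b → Contains κ k c b′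
  Contains-mono b≤b′ (a , a≤b , rest) = a , Pointwise-≤-trans a≤b b≤b′ , rest

  Contains-resp-↭ : b ↭ b′ → Contains κ k c b → Contains κ k c b′
  Contains-resp-↭ b↭b′ (a , a≤b , sum≡ , spread , κa≡c) =
    let a′ , a′↭a , a′≤b′ = ≤-across-↭ (↭-sym b↭b′) a≤b
    in a′ , a′≤b′ , trans (sum-↭ a′↭a) sum≡ , All-resp-↭ (↭-sym a′↭a) spread
     , trans (cong rule (core-cong-↭ a′↭a)) κa≡c

  Contains-positives : 0 < k → ∀ b → Contains κ k c (positives b) → Contains κ k c b
  Contains-positives {c} 0<k b (a , a≤b , sum≡ , spread , κa≡c) =
    let a′ , a′≤b , eq = ≤-of-positives b a≤b
    in a′ , a′≤b
     , (begin
          sum a′             ≡⟨ sum-positives a′ ⟨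
          sum (positives a′) ≡⟨ cong sum eq ⟩
          sum (positives a)  ≡⟨ sum-positives a ⟩
          sum a              ≡⟨ sum≡ ⟩
          k                  ∎)
     , All-positives⁻ (<⇒≢ 0<k) a′ (subst (All (_≢ k)) (sym eq) (filter⁺ (1 ≤?_) spread))
     , (begin
          κ a′                                        ≡⟨ cong (rule ∘ sort) (filter-positives a′) ⟨
          rule (sort (filter (2 ≤?_) (positives a′))) ≡⟨ cong (rule ∘ sort ∘ filter (2 ≤?_)) eq ⟩
          rule (sort (filter (2 ≤?_) (positives a)))  ≡⟨ cong (rule ∘ sort) (filter-positives a) ⟩
          κ a                                         ≡⟨ κa≡c ⟩
          c                                           ∎)
    where open ≡-Reasoning

  Contains-descending : 0 < k → ∀ b → Contains κ k c (descending b) → Contains κ k c b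
  Contains-descending 0<k b = Contains-positives 0<k b ∘ Contains-resp-↭ (sort-↭ (positives b))

  contains-removal : ∀ b → sum b ≡ suc n → {P : List ℕ → Set} →
    (∀ a → sum a ≡ n → P a → Contains κ k c a) → Any P (removals b) → Contains κ k c b
  contains-removal b sum≡ step any =
    let (a≤b , eq) , pa = All.lookupAny (removals-spec b) any
    in Contains-mono a≤b (step _ (suc-injective (trans eq sum≡)) pa)

  Spread⇒Contains : ∀ a → sum a ≡ k → Spread c a → Contains κ k c a
  Spread⇒Contains a sum≡ (spread , κa≡c) = a , Pointwise.refl ≤-refl , sum≡ , spread , κa≡c

  RedBelow⇒Contains : ∀ b → sum b ≡ k + 1 → RedBelow b → Contains κ k red b
  RedBelow⇒Contains b sum≡ =
    contains-removal b (trans sum≡ (+-comm k 1)) Spread⇒Contains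

  BlueBelow⇒Contains : ∀ b → sum b ≡ k + 2 → BlueBelow b → Contains κ k blue b
  BlueBelow⇒Contains b sum≡ =
    contains-removal b (trans sum≡ (+-comm k 2)) λ a sum≡ → contains-removal a sum≡ Spread⇒Contains

  module _ (2≤k : 2 ≤ k) where
    private 0<k = ≤-trans (s≤s z≤n) 2≤k

    -- The sizes of a set with at least k + j points, at least j of them outside
    -- each block, can be lowered to a partition of k + j into parts at most k.  The
    -- largest block is cut down to k points if necessary, so a block with two
    -- points is not lost.
    partition-below : ∀ {j} → j ≤ k → ∀ b → k + j ≤ sum b → All (λ x → x + j ≤ sum b) b →
      ∃[ μ ] μ ∈ partitions (k + j) (k + j) k × sum μ ≡ k + j ×
             (Any (2 ≤_) b → Any (2 ≤_) μ) × (∀ {c} → Contains κ k c μ → Contains κ k c b)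
    partition-below {j} j≤k b k+j≤ b-small = from-sorted (sort b) (sort-↗ b) (sort-↭ b)
      where
      from-sorted : ∀ s → Sorted s → s ↭ b →
        ∃[ μ ] μ ∈ partitions (k + j) (k + j) k × sum μ ≡ k + j ×
               (Any (2 ≤_) b → Any (2 ≤_) μ) × (∀ {c} → Contains κ k c μ → Contains κ k c b)
      from-sorted [] _ s↭b =
        contradiction (≤-trans k+j≤ (≤-reflexive (sym (sum-↭ s↭b)))) (<⇒≱ (≤-trans 0<k (m≤m+n k j)))
      from-sorted (x ∷ l) s↘ s↭b with Sorted⇒AllPairs ≥-totalOrder s↘
      ... | x≥l ∷ _ =
        let sum≡ = sum-↭ s↭b
            x+j≤ = All.head (All-resp-↭ (↭-sym s↭b) b-small)
            l′ , l′≤l , sum′≡ , l′≤k = truncate j≤k x≥l (subst (k + j ≤_) (sym sum≡) k+j≤)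
              (+-cancelˡ-≤ x j (sum l) (subst (x + j ≤_) (sym sum≡) x+j≤))
            b′ = x ⊓ k ∷ l′
        in descending b′
         , descending-∈-partitions b′ sum′≡ (m⊓n≤n x k ∷ l′≤k)
         , trans (sum-↭ (sort-↭ (positives b′))) (trans (sum-positives b′) sum′≡)
         , (λ big → Any-resp-↭ (↭-sym (sort-↭ (positives b′)))
                      (head-positive (⊓-glb (head-max x≥l (Any-resp-↭ (↭-sym s↭b) big)) 2≤k)))
         , Contains-resp-↭ s↭b ∘ Contains-mono (m⊓n≤m x k ∷ l′≤l) ∘ Contains-descending 0<k b′
        where
        head-max : ∀ {x l} → All (_≤ x) l → Any (2 ≤_) (x ∷ l) → 2 ≤ x
        head-max x≥l (here  2≤x) = 2≤x
        head-max x≥l (there any) = let y≤x , 2≤y = All.lookupAny x≥l any in ≤-trans 2≤y y≤x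

        head-positive : ∀ {x l} → 2 ≤ x → Any (2 ≤_) (positives (x ∷ l))
        head-positive {x} {l} 2≤x =
          subst (Any (2 ≤_)) (sym (filter-accept (1 ≤?_) (≤-trans (s≤s z≤n) 2≤x))) (here 2≤x)

    module _ (good : Good) where
      open Good good

      contains-red : ∀ b → k + 1 ≤ sum b → All (_< sum b) b → Contains κ k red b
      contains-red b k+1≤ b< =
        let μ , μ∈ , sum≡ , _ , lift = partition-below 0<k b k+1≤
              (All.map (λ {x} x< → subst (_≤ sum b) (+-comm 1 x) x<) b<)
        in lift (RedBelow⇒Contains μ sum≡ (All.lookup red-below μ∈))

      contains-blue : ∀ b → k + 2 ≤ sum b → All (λ x → x + 2 ≤ sum b) b → length b < sum b →
        Contains κ k blue b
      contains-blue b k+2≤ b< len< =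
        let μ , μ∈ , sum≡ , big , lift = partition-below 2≤k b k+2≤ b<
        in lift (BlueBelow⇒Contains μ sum≡ (All.lookup blue-below μ∈ (big (pigeonhole b len<))))

      recursion : ∀ {m q N} → k + 1 ≤ m → k + 1 ≤ q →
        RamseyProperty k (suc m) q (m * N) → RamseyProperty k m q N
      recursion {m} {q} k<m k<q = product-bound 0<k κ m q
        (λ b len sum≡ b< → contains-blue b
          (subst₂ _≤_ (sym (+-suc k 1)) (sym sum≡) (s≤s k<m))
          (All.map (λ {x} x<m → subst₂ _≤_ (+-comm 2 x) (sym sum≡) (s≤s x<m)) b<)
          (subst₂ _<_ (sym len) (sym sum≡) (n<1+n m)))
        (λ b sum≡ b< → contains-red b (subst (k + 1 ≤_) (sym sum≡) k<q)
          (subst (λ n → All (_< n) b) (sym sum≡) b<))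

-- The colouring of partitions of k for 8 ≤ k ≤ 25, k ≠ 9

evens odds : List ℕ → List ℕ
evens = filter λ x → x % 2 ≟ 0
odds  = filter λ x → x % 2 ≟ 1

-- Whether the partition of k with core s is red, up to the exceptions below.
-- The case split singles out the partitions with exactly one odd part x, where
-- x > 1: such a partition has no parts 1, so its core s has sum k.  This case is
-- needed for two families.  A partition of k + 1 into e even parts, e ≡ 1 (mod 3),
-- can only be lowered to partitions with one odd part and e - 1 ≡ 0 even parts,
-- which would all be blue; now lowering a largest part, unless it is 2, gives a red
-- one.  A partition of k + 2 into e ≡ 1 even parts above 2 and one odd part above 1
-- cannot be lowered by 2 to one whose number of even parts is divisible by 3; now
-- most of these partitions can be lowered to one with e even parts in which the
-- odd part is smaller than the largest part by more than 1; that one is blue.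
generic : ℕ → List ℕ → Bool
generic k s with odds s
... | x ∷ [] = if (sum s ≡ᵇ k) ∧ not (length (evens s) % 3 ≡ᵇ 2)
               then foldr _⊔_ 0 (evens s) ≤ᵇ suc x
               else not (length (evens s) % 3 ≡ᵇ 0)
... | _      = not (length (evens s) % 3 ≡ᵇ 0)

-- Cores of partitions of k whose generic colour has to be reversed for every k
-- considered: those close to 1 + 1 + ... + 1, and those close to the partition
-- with a single part k.
extremal : ℕ → List (List ℕ)
extremal k = [] ∷ (2 ∷ []) ∷ (3 ∷ []) ∷ (4 ∷ 2 ∷ []) ∷
  (if k % 2 ≡ᵇ 0
   then (k ∸ 1 ∷ []) ∷ (k ∸ 2 ∷ 2 ∷ []) ∷ (k ∸ 2 ∷ []) ∷ (k ∸ 3 ∷ 3 ∷ []) ∷ (k ∸ 3 ∷ []) ∷ []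
   else (k ∸ 2 ∷ 2 ∷ []) ∷ (k ∸ 3 ∷ 3 ∷ []) ∷ [])

-- For each k the cores of the other partitions of k whose generic colour is
-- reversed.  These lists are the result of a computer search for short ones.
sporadic : List (ℕ × List (List ℕ))
sporadic =
  (8 , (4 ∷ 4 ∷ []) ∷ (4 ∷ []) ∷ []) ∷
  (10 , (6 ∷ 4 ∷ []) ∷ (6 ∷ 2 ∷ []) ∷ (5 ∷ 5 ∷ []) ∷ (3 ∷ 2 ∷ 2 ∷ 2 ∷ []) ∷
        (replicate 5 2) ∷ []) ∷
  (11 , (7 ∷ 4 ∷ []) ∷ (4 ∷ 3 ∷ 3 ∷ []) ∷ (3 ∷ 3 ∷ []) ∷ (3 ∷ replicate 4 2) ∷
        (3 ∷ 2 ∷ []) ∷ (replicate 4 2) ∷ (2 ∷ 2 ∷ 2 ∷ []) ∷ []) ∷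
  (12 , (8 ∷ 3 ∷ []) ∷ (7 ∷ 2 ∷ []) ∷ []) ∷
  (13 , (7 ∷ 2 ∷ 2 ∷ []) ∷ (4 ∷ 3 ∷ 3 ∷ 3 ∷ []) ∷ (4 ∷ 3 ∷ 2 ∷ 2 ∷ 2 ∷ []) ∷
        (3 ∷ 3 ∷ 2 ∷ 2 ∷ 2 ∷ []) ∷ (3 ∷ replicate 5 2) ∷ (replicate 6 2) ∷
        (replicate 5 2) ∷ []) ∷
  (14 , (10 ∷ 2 ∷ []) ∷ (9 ∷ 4 ∷ []) ∷ (4 ∷ 4 ∷ 3 ∷ 3 ∷ []) ∷ []) ∷
  (15 , (11 ∷ 4 ∷ []) ∷ (10 ∷ 5 ∷ []) ∷ (9 ∷ 6 ∷ []) ∷ (9 ∷ 2 ∷ 2 ∷ []) ∷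
        (6 ∷ 4 ∷ 4 ∷ []) ∷ (5 ∷ 4 ∷ 4 ∷ 2 ∷ []) ∷ (4 ∷ 4 ∷ 3 ∷ 3 ∷ []) ∷
        (3 ∷ replicate 5 2) ∷ []) ∷
  (16 , (11 ∷ 4 ∷ []) ∷ (11 ∷ 2 ∷ []) ∷ (6 ∷ 4 ∷ 3 ∷ 3 ∷ []) ∷ (3 ∷ replicate 6 2) ∷
        (replicate 8 2) ∷ []) ∷
  (17 , (11 ∷ 2 ∷ 2 ∷ []) ∷ (7 ∷ 4 ∷ 2 ∷ 2 ∷ 2 ∷ []) ∷ (5 ∷ 5 ∷ 4 ∷ 3 ∷ []) ∷
        (4 ∷ 4 ∷ 4 ∷ 3 ∷ 2 ∷ []) ∷ (3 ∷ replicate 7 2) ∷ (replicate 7 2) ∷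
        (replicate 6 2) ∷ (replicate 5 2) ∷ []) ∷
  (18 , (14 ∷ 3 ∷ []) ∷ (13 ∷ 2 ∷ []) ∷ (7 ∷ 4 ∷ 4 ∷ 3 ∷ []) ∷ (6 ∷ 5 ∷ 4 ∷ 3 ∷ []) ∷
        []) ∷
  (19 , (13 ∷ 2 ∷ 2 ∷ []) ∷ (12 ∷ 7 ∷ []) ∷ (11 ∷ 8 ∷ []) ∷ (6 ∷ 5 ∷ 5 ∷ 3 ∷ []) ∷
        (5 ∷ 4 ∷ 4 ∷ 4 ∷ 2 ∷ []) ∷ (5 ∷ replicate 7 2) ∷ (4 ∷ 4 ∷ 3 ∷ 2 ∷ 2 ∷ 2 ∷ []) ∷
        (3 ∷ 3 ∷ replicate 6 2) ∷ (3 ∷ replicate 8 2) ∷ (replicate 9 2) ∷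
        (replicate 8 2) ∷ []) ∷
  (20 , (16 ∷ 2 ∷ []) ∷ (15 ∷ 4 ∷ []) ∷ (9 ∷ 4 ∷ 4 ∷ 3 ∷ []) ∷ (6 ∷ 6 ∷ 4 ∷ 4 ∷ []) ∷
        (6 ∷ 5 ∷ 4 ∷ 4 ∷ []) ∷ []) ∷
  (21 , (13 ∷ replicate 4 2) ∷ (9 ∷ 6 ∷ 2 ∷ 2 ∷ 2 ∷ []) ∷ (9 ∷ replicate 5 2) ∷
        (7 ∷ 6 ∷ 5 ∷ 3 ∷ []) ∷ (7 ∷ 5 ∷ 5 ∷ 2 ∷ 2 ∷ []) ∷ (4 ∷ 4 ∷ 3 ∷ replicate 5 2) ∷
        (3 ∷ replicate 8 2) ∷ []) ∷
  (22 , (18 ∷ 3 ∷ []) ∷ (17 ∷ 2 ∷ []) ∷ (12 ∷ 4 ∷ 3 ∷ 3 ∷ []) ∷ (8 ∷ 6 ∷ 4 ∷ 4 ∷ []) ∷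
        (7 ∷ 6 ∷ 4 ∷ 4 ∷ []) ∷ (6 ∷ 6 ∷ 5 ∷ 5 ∷ []) ∷ (3 ∷ replicate 9 2) ∷
        (replicate 11 2) ∷ []) ∷
  (23 , (15 ∷ replicate 4 2) ∷ (14 ∷ 9 ∷ []) ∷ (13 ∷ 10 ∷ []) ∷ (9 ∷ replicate 7 2) ∷
        (7 ∷ 7 ∷ 6 ∷ 3 ∷ []) ∷ (7 ∷ 6 ∷ 5 ∷ 5 ∷ []) ∷ (7 ∷ 4 ∷ replicate 6 2) ∷
        (6 ∷ 6 ∷ 5 ∷ 5 ∷ []) ∷ (4 ∷ 4 ∷ 4 ∷ 3 ∷ 3 ∷ 3 ∷ 2 ∷ []) ∷
        (4 ∷ 4 ∷ 4 ∷ 3 ∷ replicate 4 2) ∷ (3 ∷ replicate 10 2) ∷ (replicate 10 2) ∷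
        (replicate 9 2) ∷ (replicate 8 2) ∷ []) ∷
  (24 , (19 ∷ 4 ∷ []) ∷ (19 ∷ 2 ∷ []) ∷ (13 ∷ 4 ∷ 4 ∷ 3 ∷ []) ∷ (11 ∷ 6 ∷ 4 ∷ 3 ∷ []) ∷
        (9 ∷ 7 ∷ 4 ∷ 4 ∷ []) ∷ (8 ∷ 6 ∷ 6 ∷ 4 ∷ []) ∷ (8 ∷ 6 ∷ 6 ∷ 3 ∷ []) ∷ []) ∷
  (25 , (19 ∷ 2 ∷ 2 ∷ []) ∷ (11 ∷ 9 ∷ 2 ∷ 2 ∷ []) ∷ (11 ∷ replicate 7 2) ∷
        (7 ∷ 7 ∷ 7 ∷ 4 ∷ []) ∷ (7 ∷ 6 ∷ 5 ∷ 5 ∷ 2 ∷ []) ∷ (5 ∷ 4 ∷ 4 ∷ 4 ∷ 4 ∷ 3 ∷ []) ∷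
        (5 ∷ replicate 10 2) ∷ (4 ∷ 4 ∷ 4 ∷ 4 ∷ 3 ∷ 2 ∷ 2 ∷ 2 ∷ []) ∷
        (4 ∷ 3 ∷ replicate 9 2) ∷ (3 ∷ 3 ∷ replicate 9 2) ∷ (3 ∷ replicate 11 2) ∷
        (replicate 12 2) ∷ (replicate 11 2) ∷ []) ∷
  []

exceptions : ℕ → List (List ℕ)
exceptions k = extremal k ++ concatMap proj₂ (filter ((k ≟_) ∘ proj₁) sporadic)

rule : ℕ → List ℕ → Colour
rule k s = if generic k s xor does (s ∈? exceptions k) then red else blue

_≟ᶜ_ : (c d : Colour) → Dec (c ≡ d)
red  ≟ᶜ red  = yes refl
red  ≟ᶜ blue = no λ ()
blue ≟ᶜ red  = no λ ()
blue ≟ᶜ blue = yes refl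

good? : ∀ k rule → Dec (BlockRule.Good k rule)
good? k rule = map′ (λ (r , b) → record { red-below = r ; blue-below = b })
                    (λ g → Good.red-below g , Good.blue-below g)
  (all? (λ μ → any? (spread? red) _) _ ×-dec
   all? (λ μ → any? (2 ≤?_) μ →-dec any? (λ a → any? (spread? blue) (removals a)) _) _)
  where
  open BlockRule k rule

  spread? : ∀ c a → Dec (Spread c a)
  spread? c a = all? (λ x → ¬? (x ≟ k)) a ×-dec κ a ≟ᶜ c

good : ∀ k → 8 ≤ k → k ≤ 25 → k ≢ 9 → BlockRule.Good k (rule k)
good k 8≤k k≤25 = All.lookup verified
  (subst (_∈ applyUpTo (8 +_) 18) (m+[n∸m]≡n 8≤k)
         (∈-applyUpTo⁺ (8 +_) (s≤s (∸-monoˡ-≤ 8 k≤25))))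
  where
  -- For k = 9 nothing is evaluated, because k ≢ 9 is refuted first.
  verified : All (λ k → k ≢ 9 → BlockRule.Good k (rule k)) (applyUpTo (8 +_) 18)
  verified = from-yes (all? (λ k → ¬? (k ≟ 9) →-dec good? k (rule k)) (applyUpTo (8 +_) 18))

-- The lower bound

ramsey-number-positive : ∀ {p q} → 0 < p → 0 < q → IsRamseyNumber k p q n → 0 < n
ramsey-number-positive {n = suc n} _   _   _ = s≤s z≤n
ramsey-number-positive {n = zero}  0<p 0<q R with IsRamseyNumber.ramsey R (λ _ → red)
... | inj₁ (s , refl , _) = ≤-trans 0<p (∣p∣≤n s)
... | inj₂ (s , refl , _) = ≤-trans 0<q (∣p∣≤n s)

theorem3 : ∃[ c ] (c ≥ 25 ×
    (∀ k → 8 ≤ k → k ≤ c → k ≢ 9 →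
    ∀ p q → p ≥ k + 2 → q ≥ k + 1 →
    ∀ r r′ → IsRamseyNumber k p q r → IsRamseyNumber k (p ∸ 1) q r′ →
    r ≥ (p ∸ 1) * (r′ ∸ 1) + 1))
theorem3 = 25 , ≤-refl , bound
  where
  bound : ∀ k → 8 ≤ k → k ≤ 25 → k ≢ 9 →
    ∀ p q → p ≥ k + 2 → q ≥ k + 1 →
    ∀ r r′ → IsRamseyNumber k p q r → IsRamseyNumber k (p ∸ 1) q r′ →
    r ≥ (p ∸ 1) * (r′ ∸ 1) + 1
  bound k _   _    _   zero    q p≥ _  r r′ R R′ = contradiction (≤-trans (m≤n+m 2 k) p≥) λ ()
  bound k 8≤k k≤25 k≢9 (suc m) q p≥ q≥ r r′ R R′ = ≮⇒≥ λ r< →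
    let r≤mN = s≤s⁻¹ (subst (r <_) (+-comm (m * (r′ ∸ 1)) 1) r<)
        smaller = recursion (≤-trans (s≤s (s≤s z≤n)) 8≤k) (good k 8≤k k≤25 k≢9) m≥ q≥
                    (ramsey-mono r≤mN (IsRamseyNumber.ramsey R))
        0<r′ = ramsey-number-positive (≤-trans (m≤n+m 1 k) m≥) (≤-trans (m≤n+m 1 k) q≥) R′
    in <⇒≱ (∸-monoʳ-< (s≤s z≤n) 0<r′) (IsRamseyNumber.minimal R′ (r′ ∸ 1) smaller)
    where
    open BlockRule k (rule k)
    m≥ : m ≥ k + 1
    m≥ = s≤s⁻¹ (subst (_≤ suc m) (+-suc k 1) p≥)
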